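{- The mesh patterns $$m_1=(12,\{(0,0),(0,2),(1,1),(1,2),(2,1)\})\quad\text{and}\quad m_2=(12,\{(0,0),(0,1),(0,2),(1,1),(1,2),(2,1)\})$$ are coincident under $321$, i.e. $\mathrm{Av}(\{321,m_1\})=\mathrm{Av}(\{321,m_2\})$.
   Context: Write $[n]=\{1,\dots,n\}$. A permutation of length $n$ is a bijection of $[n]$, written in one-line notation; $G(\pi)=\{(i,\pi(i)) : i\in[n]\}$ is its plot. A mesh pattern of length $k$ is a pair $p=(\tau,R)$ with $\tau$ a permutation of length $k$ and $R\subseteq\{0,\dots,k\}^2$. An occurrence of $p$ in a permutation $\pi$ of length $n$ is a subset $\omega\subseteq G(\pi)$ for which there are order-preserving injections $\alpha,\beta:[k]\to[n]$ such that (i) $\omega=\{(\alpha(i),\beta(j)):(i,j)\in G(\tau)\}$, and (ii) with $\alpha(0)=\beta(0)=0$, $\alpha(k+1)=\beta(k+1)=n+1$ and $R_{ij}=[\alpha(i)+1,\alpha(i+1)-1]\times[\beta(j)+1,\beta(j+1)-1]$, one has $R_{ij}\cap G(\pi)=\emptyset$ for every $(i,j)\in R$. A permutation avoids $p$ if it has no occurrence of $p$. A classical pattern $\pi$ is identified with the mesh pattern $(\pi,\emptyset)$. $\mathrm{Av}(S)$ is the set of all permutations (of all lengths) avoiding every pattern in $S$. -}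

module Defs where

open import Data.Fin.Base using (Fin; zero; suc; inject₁; toℕ)
import Data.Fin.Base as Fin
open import Data.Fin.Patterns using (0F; 1F; 2F)
open import Data.Fin.Permutation using (Permutation′; _⟨$⟩ʳ_; id; reverse)
open import Data.List.Base using (List; []; _∷_)
import Data.List.Membership.Propositional as List
open import Data.Nat.Base using (ℕ; zero; suc; _<_)
open import Data.Product.Base using (∃; ∃-syntax; _×_; _,_)
open import Function.Base using (_∘_)
open import Function.Definitions using (Injective)
open import Level using (0ℓ; _⊔_) renaming (suc to lsuc)
open import Relation.Binary.Definitions using (Monotonic₁)
open import Relation.Binary.PropositionalEquality.Core using (_≡_)
open import Relation.Nullary.Negation.Core using (¬_)
open import Relation.Unary using (Pred; _∈_; _⊆_; _≐_; _∩_; ∅; Empty)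

-- [n] is represented by Fin n, whose elements are counted from 0:
-- x : Fin n stands for the number ⟦ x ⟧ ∈ {1, …, n}.

⟦_⟧ : ∀ {n} → Fin n → ℕ
⟦ x ⟧ = suc (toℕ x)

G : ∀ {n} → Permutation′ n → Pred (Fin n × Fin n) 0ℓ
G π (x , y) = π ⟨$⟩ʳ x ≡ y

record MeshPattern : Set₁ where
  constructor mesh
  field
    {len} : ℕ
    τ     : Permutation′ len
    R     : Pred (Fin (suc len) × Fin (suc len)) 0ℓ

OrderPreservingInjection : ∀ {k n} → (Fin k → Fin n) → Set
OrderPreservingInjection α =
  Monotonic₁ Fin._≤_ Fin._≤_ α × Injective _≡_ _≡_ α

-- The extension of α : [k] → [n] to {0, …, k + 1} by α(0) = 0 and
-- α(k + 1) = n + 1; extend⁺ is its restriction to {1, …, k + 1}.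

extend⁺ : ∀ {k n} → (Fin k → Fin n) → Fin (suc k) → ℕ
extend⁺ {zero}  {n} α zero    = suc n
extend⁺ {suc k}     α zero    = ⟦ α zero ⟧
extend⁺ {suc k}     α (suc i) = extend⁺ (α ∘ suc) i

extend : ∀ {k n} → (Fin k → Fin n) → Fin (suc (suc k)) → ℕ
extend α zero    = 0
extend α (suc i) = extend⁺ α i

-- R_ij. Over ℕ, x ∈ [a + 1, b - 1] is written a < x × x < b.

Box : ∀ {k n} (α β : Fin k → Fin n) (i j : Fin (suc k)) →
      Pred (Fin n × Fin n) 0ℓ
Box α β i j (x , y) =
  (extend α (inject₁ i) < ⟦ x ⟧ × ⟦ x ⟧ < extend α (suc i)) ×
  (extend β (inject₁ j) < ⟦ y ⟧ × ⟦ y ⟧ < extend β (suc j))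

Image : ∀ {k n} → Permutation′ k → (α β : Fin k → Fin n) →
        Pred (Fin n × Fin n) 0ℓ
Image τ α β (x , y) =
  ∃[ i ] ∃[ j ] ((i , j) ∈ G τ × x ≡ α i × y ≡ β j)

record Occurrence (p : MeshPattern) {n : ℕ} (π : Permutation′ n)
                  (ω : Pred (Fin n × Fin n) 0ℓ) : Set where
  open MeshPattern p
  field
    ω⊆G   : ω ⊆ G π
    α β   : Fin len → Fin n
    α-inj : OrderPreservingInjection α
    β-inj : OrderPreservingInjection β
    image : ω ≐ Image τ α β
    empty : ∀ i j → (i , j) ∈ R → Empty (Box α β i j ∩ G π)

Avoids : ∀ {n} → Permutation′ n → MeshPattern → Set₁
Avoids π p = ∀ ω → ¬ Occurrence p π ω

Av : ∀ {ℓ} → Pred MeshPattern ℓ → Pred (∃ Permutation′) (lsuc 0ℓ ⊔ ℓ)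
Av S (n , π) = ∀ p → p ∈ S → Avoids π p

classical : ∀ {k} → Permutation′ k → MeshPattern
classical τ = mesh τ ∅

p₃₂₁ : MeshPattern
p₃₂₁ = classical (reverse {3})

m₁ : MeshPattern
m₁ = mesh (id {2})
  (List._∈ ((0F , 0F) ∷ (0F , 2F) ∷ (1F , 1F) ∷ (1F , 2F) ∷ (2F , 1F) ∷ []))

m₂ : MeshPattern
m₂ = mesh (id {2})
  (List._∈ ((0F , 0F) ∷ (0F , 1F) ∷ (0F , 2F) ∷ (1F , 1F) ∷ (1F , 2F) ∷ (2F , 1F) ∷ []))

{-# OPTIONS --safe #-}

-- Every m₂-occurrence is an m₁-occurrence, so only the converse matters.  Let
-- the points of π in positions a < c form an m₁-occurrence.  The points to the
-- left of a have values strictly between π(a) and π(c), and they increase,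
-- since a descent among them followed by a would be a 321.  If a is the first
-- position, the occurrence is one of m₂.  If a is the second position, the
-- first position and c form an m₂-occurrence.  Otherwise the first two
-- positions do.

module Submission where

open import Defs
open import Relation.Unary using (_≐_; _∪_; ｛_｝)

open import Data.Fin.Base using (Fin; zero; suc; toℕ; _<_; _≤_)
open import Data.Fin.Patterns using (0F; 1F; 2F)
open import Data.Fin.Permutation using (Permutation′; _⟨$⟩ʳ_)
open import Data.Fin.Properties
  using (<-cmp; <⇒≢; ≤∧≢⇒<; toℕ<n)
open import Data.List.Relation.Unary.Any using (here; there)
open import Data.Nat.Base as ℕ using (zero; suc; z<s; s≤s; s<s; s<s⁻¹)
import Data.Nat.Properties as ℕ
open import Data.Product.Base using (∃; _×_; _,_; proj₂)
open import Data.Sum.Base using (inj₁; inj₂)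
open import Data.Vec.Functional using ([]; _∷_)
open import Function.Base using (_∘_)
open import Function.Bundles using (Injection)
open import Function.Properties.Inverse using (↔⇒↣)
open import Relation.Binary.Definitions using (tri<; tri≈; tri>)
open import Relation.Binary.PropositionalEquality
  using (_≡_; refl; sym; cong)
open import Relation.Nullary.Negation using (¬_; contradiction)
open import Relation.Unary using (Pred; _⊆_)

[]-order-preserving : ∀ {n} → OrderPreservingInjection {0} {n} []
[]-order-preserving = (λ { {()} }) , (λ { {()} })

∷-order-preserving : ∀ {k n} {x : Fin n} {α : Fin k → Fin n} →
  (∀ i → x < α i) → OrderPreservingInjection α →
  OrderPreservingInjection (x ∷ α)
∷-order-preserving {x = x} {α} x<α (mono , inj) = mono′ , inj′
  where
  mono′ : ∀ {i j} → i ≤ j → (x ∷ α) i ≤ (x ∷ α) j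
  mono′ {zero}  {zero}  _         = ℕ.≤-refl
  mono′ {zero}  {suc j} _         = ℕ.<⇒≤ (x<α j)
  mono′ {suc i} {suc j} (s≤s i≤j) = mono i≤j

  inj′ : ∀ {i j} → (x ∷ α) i ≡ (x ∷ α) j → i ≡ j
  inj′ {zero}  {zero}  _  = refl
  inj′ {zero}  {suc j} eq = contradiction eq (<⇒≢ (x<α j))
  inj′ {suc i} {zero}  eq = contradiction (sym eq) (<⇒≢ (x<α i))
  inj′ {suc i} {suc j} eq = cong suc (inj eq)

pair-order-preserving : ∀ {n} {x y : Fin n} → x < y →
  OrderPreservingInjection (x ∷ y ∷ [])
pair-order-preserving x<y =
  ∷-order-preserving (λ { 0F → x<y }) (∷-order-preserving (λ ()) []-order-preserving)

triple-order-preserving : ∀ {n} {x y z : Fin n} → x < y → y < z →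
  OrderPreservingInjection (x ∷ y ∷ z ∷ [])
triple-order-preserving x<y y<z =
  ∷-order-preserving (λ { 0F → x<y ; 1F → ℕ.<-trans x<y y<z }) (pair-order-preserving y<z)

order-preserving⇒< : ∀ {k n} {α : Fin k → Fin n} →
  OrderPreservingInjection α → ∀ {i j} → i < j → α i < α j
order-preserving⇒< (mono , inj) i<j =
  ≤∧≢⇒< (mono (ℕ.<⇒≤ i<j)) (<⇒≢ i<j ∘ inj)

-- The same `α` and `β` serve: shading fewer boxes only drops emptiness conditions.
occurrence-⊆ : ∀ {k} {τ : Permutation′ k} {R S : Pred (Fin _ × Fin _) _} →
  R ⊆ S → ∀ {n} {π : Permutation′ n} {ω} →
  Occurrence (mesh τ S) π ω → Occurrence (mesh τ R) π ω
occurrence-⊆ R⊆S occ = record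
  { ω⊆G = ω⊆G ; α = α ; β = β ; α-inj = α-inj ; β-inj = β-inj ; image = image
  ; empty = λ i j → empty i j ∘ R⊆S
  }
  where open Occurrence occ

occurrence-point : ∀ {k} {τ : Permutation′ k} {R n} {π : Permutation′ n} {ω}
  (occ : Occurrence (mesh τ R) π ω) → let open Occurrence occ in
  ∀ i → π ⟨$⟩ʳ α i ≡ β (τ ⟨$⟩ʳ i)
occurrence-point occ i = ω⊆G (proj₂ image (i , _ , refl , refl , refl))
  where open Occurrence occ

module _ {n} (π : Permutation′ n) where

  no-321 : Avoids π p₃₂₁ → ∀ {i j k} → i < j → j < k →
    π ⟨$⟩ʳ j < π ⟨$⟩ʳ i → ¬ (π ⟨$⟩ʳ k < π ⟨$⟩ʳ j)
  no-321 avoids {i} {j} {k} i<j j<k πj<πi πk<πj = avoids _ record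
    { ω⊆G   = λ { (0F , _ , refl , refl , refl) → refl
                ; (1F , _ , refl , refl , refl) → refl
                ; (2F , _ , refl , refl , refl) → refl }
    ; α     = i ∷ j ∷ k ∷ []
    -- `β` must increase, so the values of a decreasing triple are listed from the last position
    -- back to the first.
    ; β     = (π ⟨$⟩ʳ k) ∷ (π ⟨$⟩ʳ j) ∷ (π ⟨$⟩ʳ i) ∷ []
    ; α-inj = triple-order-preserving i<j j<k
    ; β-inj = triple-order-preserving πk<πj πj<πi
    ; image = (λ p → p) , (λ p → p)
    ; empty = λ _ _ ()
    }

  π-injective : ∀ {i j} → π ⟨$⟩ʳ i ≡ π ⟨$⟩ʳ j → i ≡ j
  π-injective = Injection.injective (↔⇒↣ π)

  ≮⇒> : ∀ {i j} → ¬ i ≡ j → ¬ (π ⟨$⟩ʳ i < π ⟨$⟩ʳ j) → π ⟨$⟩ʳ j < π ⟨$⟩ʳ i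
  ≮⇒> {i} {j} i≢j ≮ with <-cmp (π ⟨$⟩ʳ i) (π ⟨$⟩ʳ j)
  ... | tri< lt _ _ = contradiction lt ≮
  ... | tri≈ _ eq _ = contradiction (π-injective eq) i≢j
  ... | tri> _ _ gt = gt

  -- Positions alone determine an occurrence. The two `left` fields are boxes (0,0) and (0,2),
  -- `mid-≤πa` merges (1,1) and (1,2), and `right` is (2,1). Box (0,1), the only one in which `m₂`
  -- differs, stays unconstrained.
  record M₁At (a c : Fin n) : Set where
    field
      a<c      : a < c
      πa<πc    : π ⟨$⟩ʳ a < π ⟨$⟩ʳ c
      left-≥πa : ∀ x → x < a → ¬ (π ⟨$⟩ʳ x < π ⟨$⟩ʳ a)
      left-≤πc : ∀ x → x < a → ¬ (π ⟨$⟩ʳ c < π ⟨$⟩ʳ x)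
      mid-≤πa  : ∀ x → a < x → x < c → ¬ (π ⟨$⟩ʳ a < π ⟨$⟩ʳ x)
      right    : ∀ x → c < x → π ⟨$⟩ʳ a < π ⟨$⟩ʳ x → ¬ (π ⟨$⟩ʳ x < π ⟨$⟩ʳ c)

  occurrence⇒M₁At : ∀ {ω} → Occurrence m₁ π ω → ∃ λ a → ∃ λ c → M₁At a c
  occurrence⇒M₁At occ = α 0F , α 1F , at
    where
    open Occurrence occ

    α₀<α₁ : α 0F < α 1F
    α₀<α₁ = order-preserving⇒< α-inj z<s

    π₀ : π ⟨$⟩ʳ α 0F ≡ β 0F
    π₀ = occurrence-point occ 0F

    π₁ : π ⟨$⟩ʳ α 1F ≡ β 1F
    π₁ = occurrence-point occ 1F

    π-mono : π ⟨$⟩ʳ α 0F < π ⟨$⟩ʳ α 1F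
    π-mono rewrite π₀ | π₁ = order-preserving⇒< β-inj z<s

    left-≥ : ∀ x → x < α 0F → ¬ (π ⟨$⟩ʳ x < π ⟨$⟩ʳ α 0F)
    left-≥ x x<a πx<πa rewrite π₀ =
      empty 0F 0F (here refl) _ (((z<s , s<s x<a) , (z<s , s<s πx<πa)) , refl)

    left-≤ : ∀ x → x < α 0F → ¬ (π ⟨$⟩ʳ α 1F < π ⟨$⟩ʳ x)
    left-≤ x x<a πc<πx rewrite π₁ =
      empty 0F 2F (there (here refl)) _
        (((z<s , s<s x<a) , (s<s πc<πx , s<s (toℕ<n _))) , refl)

    mid : ∀ x → α 0F < x → x < α 1F → ¬ (π ⟨$⟩ʳ α 0F < π ⟨$⟩ʳ x)
    -- The value of `π` at `α 1F` separates boxes (1,1) and (1,2) and lies in neither; injectivity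
    -- of `π` excludes it.
    mid x a<x x<c πa<πx with <-cmp (π ⟨$⟩ʳ x) (π ⟨$⟩ʳ α 1F)
    ... | tri< πx<πc _ _ rewrite π₀ | π₁ =
      empty 1F 1F (there (there (here refl))) _
        (((s<s a<x , s<s x<c) , (s<s πa<πx , s<s πx<πc)) , refl)
    ... | tri≈ _ πx≡πc _ =
      <⇒≢ x<c (π-injective πx≡πc)
    ... | tri> _ _ πc<πx rewrite π₁ =
      empty 1F 2F (there (there (there (here refl)))) _
        (((s<s a<x , s<s x<c) , (s<s πc<πx , s<s (toℕ<n _))) , refl)

    right-∉ : ∀ x → α 1F < x → π ⟨$⟩ʳ α 0F < π ⟨$⟩ʳ x → ¬ (π ⟨$⟩ʳ x < π ⟨$⟩ʳ α 1F)
    right-∉ x c<x πa<πx πx<πc rewrite π₀ | π₁ =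
      empty 2F 1F (there (there (there (there (here refl))))) _
        (((s<s c<x , s<s (toℕ<n x)) , (s<s πa<πx , s<s πx<πc)) , refl)

    at : M₁At (α 0F) (α 1F)
    at = record
      { a<c = α₀<α₁ ; πa<πc = π-mono
      ; left-≥πa = left-≥ ; left-≤πc = left-≤ ; mid-≤πa = mid ; right = right-∉ }

module _ {n} (π : Permutation′ (suc n)) where

  -- With `a` at the first position the column to its left contains no positions, so the extra box
  -- (0,1) of `m₂` is empty for free.
  M₁At-first⇒m₂ : ∀ {c} → M₁At π zero c → ¬ Avoids π m₂
  M₁At-first⇒m₂ {c} at avoids = avoids _ record
    { ω⊆G   = λ { (0F , _ , refl , refl , refl) → refl
                ; (1F , _ , refl , refl , refl) → refl }
    ; α     = zero ∷ c ∷ []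
    ; β     = (π ⟨$⟩ʳ zero) ∷ (π ⟨$⟩ʳ c) ∷ []
    ; α-inj = pair-order-preserving a<c
    ; β-inj = pair-order-preserving πa<πc
    ; image = (λ p → p) , (λ p → p)
    ; empty = λ
      { _ _ (here refl) (_ , _) (((_ , s<s ()) , _) , _)
      ; _ _ (there (here refl)) (_ , _) (((_ , s<s ()) , _) , _)
      ; _ _ (there (there (here refl))) (_ , _) (((_ , s<s ()) , _) , _)
      ; _ _ (there (there (there (here refl)))) (x , _)
          (((a<x , x<c) , (πa<πx , _)) , refl) →
          mid-≤πa x (s<s⁻¹ a<x) (s<s⁻¹ x<c) (s<s⁻¹ πa<πx)
      -- A point of box (1,2) lies above `c`, hence above the first point, so the merged field
      -- covers it too.
      ; _ _ (there (there (there (there (here refl))))) (x , _)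
          (((a<x , x<c) , (πc<πx , _)) , refl) →
          mid-≤πa x (s<s⁻¹ a<x) (s<s⁻¹ x<c) (ℕ.<-trans πa<πc (s<s⁻¹ πc<πx))
      ; _ _ (there (there (there (there (there (here refl)))))) (x , _)
          (((c<x , _) , (πa<πx , πx<πc)) , refl) →
          right x (s<s⁻¹ c<x) (s<s⁻¹ πa<πx) (s<s⁻¹ πx<πc)
      }
    }
    where open M₁At at

M₁At⇒M₁At-first : ∀ {n} (π : Permutation′ (suc n)) → Avoids π p₃₂₁ →
  ∀ {a c} → M₁At π a c → ∃ (M₁At π zero)
M₁At⇒M₁At-first π avoids {zero}  {c} at = c , at
M₁At⇒M₁At-first π avoids {1F}    {c} at = c , record
  { a<c      = ℕ.<-trans z<s a<c
  ; πa<πc    = ≮⇒> π (λ { refl → ℕ.n≮0 a<c }) (left-≤πc 0F z<s)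
  ; left-≥πa = λ _ ()
  ; left-≤πc = λ _ ()
  -- The old `a` now lies between the chosen positions, but below the new first point. Any other
  -- point above the new first point is also above the old `a`, so the old conditions apply.
  ; mid-≤πa  = λ
    { 1F _ _ π₀<πa → ℕ.<-asym π₀<πa πa<π₀
    ; (suc (suc x)) _ x<c π₀<πx →
        mid-≤πa (suc (suc x)) (s<s z<s) x<c (ℕ.<-trans πa<π₀ π₀<πx) }
  ; right    = λ x c<x π₀<πx → right x c<x (ℕ.<-trans πa<π₀ π₀<πx)
  }
  where
  open M₁At at

  πa<π₀ : π ⟨$⟩ʳ 1F < π ⟨$⟩ʳ 0F
  πa<π₀ = ≮⇒> π (λ ()) (left-≥πa 0F z<s)
M₁At⇒M₁At-first π avoids {a@(suc (suc _))} {c} at = 1F , record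
  { a<c      = z<s
  -- A descent at the first two positions, followed by the lower point at `a`, would be a 321.
  ; πa<πc    = ≮⇒> π (λ ()) λ π₁<π₀ → no-321 π avoids z<s (s<s z<s) π₁<π₀ (πa<πleft (s<s z<s))
  ; left-≥πa = λ _ ()
  ; left-≤πc = λ _ ()
  -- No position lies strictly between the first two.
  ; mid-≤πa  = λ { (suc x) _ (s<s ()) }
  ; right    = right′
  }
  where
  open M₁At at

  πa<πleft : ∀ {x} → x < a → π ⟨$⟩ʳ a < π ⟨$⟩ʳ x
  πa<πleft x<a = ≮⇒> π (<⇒≢ x<a) (left-≥πa _ x<a)

  π₁<πc : π ⟨$⟩ʳ 1F < π ⟨$⟩ʳ c
  π₁<πc = ≮⇒> π (<⇒≢ (ℕ.<-trans (s<s z<s) a<c) ∘ sym) (left-≤πc 1F (s<s z<s))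

  right′ : ∀ x → 1 ℕ.< toℕ x → π ⟨$⟩ʳ 0F < π ⟨$⟩ʳ x → ¬ (π ⟨$⟩ʳ x < π ⟨$⟩ʳ 1F)
  right′ x 1<x π₀<πx πx<π₁ with <-cmp x a | <-cmp x c
  -- Before `a`, positions `1F`, `x`, `a` form a 321. At `a` the value is too low, at `c` too high.
  -- Elsewhere `x` lies above `a` and below `c` in value, so `mid-≤πa` or `right` of the old pair
  -- forbids it.
  ... | tri< x<a _ _ | _ = no-321 π avoids 1<x x<a πx<π₁ (πa<πleft x<a)
  ... | tri≈ _ refl _ | _ = ℕ.<-asym π₀<πx (πa<πleft z<s)
  ... | tri> _ _ a<x | tri< x<c _ _ = mid-≤πa x a<x x<c (ℕ.<-trans (πa<πleft z<s) π₀<πx)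
  ... | tri> _ _ _   | tri≈ _ refl _ = ℕ.<-asym πx<π₁ π₁<πc
  ... | tri> _ _ _   | tri> _ _ c<x =
    right x c<x (ℕ.<-trans (πa<πleft z<s) π₀<πx) (ℕ.<-trans πx<π₁ π₁<πc)

m₂-avoids⇒m₁-avoids : ∀ {n} (π : Permutation′ n) →
  Avoids π p₃₂₁ → Avoids π m₂ → Avoids π m₁
-- Length zero is split off because the argument needs a first position; there `α 0F` would inhabit
-- an empty type.
m₂-avoids⇒m₁-avoids {zero} π _ _ _ occ with Occurrence.α occ 0F
... | ()
m₂-avoids⇒m₁-avoids {suc n} π avoids₃₂₁ avoids _ occ =
  let _ , _ , at  = occurrence⇒M₁At π occ
      _ , at₀     = M₁At⇒M₁At-first π avoids₃₂₁ at
  in M₁At-first⇒m₂ π at₀ avoids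

-- The list of `m₂` inserts `(0F , 1F)` in second place, so every later membership index shifts by
-- one.
R₁⊆R₂ : MeshPattern.R m₁ ⊆ MeshPattern.R m₂
R₁⊆R₂ (here eq)         = here eq
R₁⊆R₂ (there (here eq)) = there (there (here eq))
R₁⊆R₂ (there (there p)) = there (there (there p))

mainTheorem11 : Av (｛ p₃₂₁ ｝ ∪ ｛ m₁ ｝) ≐ Av (｛ p₃₂₁ ｝ ∪ ｛ m₂ ｝)
mainTheorem11 =
    (λ { av _ (inj₁ refl) → av _ (inj₁ refl)
       ; av _ (inj₂ refl) → λ ω occ → av _ (inj₂ refl) ω (occurrence-⊆ R₁⊆R₂ occ) })
  , (λ { av _ (inj₁ refl) → av _ (inj₁ refl)
       ; {_ , π} av _ (inj₂ refl) →
           m₂-avoids⇒m₁-avoids π (av _ (inj₁ refl)) (av _ (inj₂ refl)) })
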